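{- Suppose $\kappa$ is an infinite regular cardinal and $\lambda=\kappa^+=\mathfrak{b}_\kappa=\operatorname{stick}(\kappa)$. Then $\lambda\kappa\not\longrightarrow(\lambda\kappa,3)^2$.
   Context: $\mathfrak{b}_\kappa$ is the unbounding number at $\kappa$: the least cardinality of a family $U$ of functions from $\kappa$ to $\kappa$ such that no single $g:\kappa\to\kappa$ satisfies, for every $u\in U$, $|\{\iota<\kappa: u(\iota)\geq g(\iota)\}|<\kappa$. Writing $[Y]^\mu$ for the set of subsets of $Y$ of cardinality $\mu$, $\operatorname{stick}(\kappa)$ is the least cardinality of a family $X\subseteq[\kappa^+]^\kappa$ such that for every $y\in[\kappa^+]^{\kappa^+}$ there is $x\in X$ with $x\subseteq y$. $\lambda\kappa$ is the ordinal product: the order type of $\kappa$ many copies of $\lambda$ placed one after another. For linear order types $\tau,\varphi$ and $n<\omega$, $\tau\longrightarrow(\varphi,n)^2$ means: whenever $P$ is a linear order of type $\tau$ and $f:[P]^2\to\{0,1\}$ (where $[P]^2$ is the set of two-element subsets of $P$), either there is a suborder $Q\subseteq P$ of type $\varphi$ with $f$ constantly $0$ on $[Q]^2$, or there is $Q\subseteq P$ with $n$ elements with $f$ constantly $1$ on $[Q]^2$; $\not\longrightarrow$ is its negation. -}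

module Defs where

open import Level using (Level; _⊔_) renaming (suc to lsuc)
open import Data.Fin using (Fin)
open import Data.Fin.Patterns using (0F; 1F)
open import Data.Nat using (ℕ)
open import Data.Product using (Σ; _×_; _,_; proj₁; ∃-syntax; Σ-syntax)
open import Data.Product.Relation.Binary.Lex.Strict using (×-strictTotalOrder)
open import Data.Sum using (_⊎_; inj₁; inj₂)
open import Function.Bundles using (Func; Injection; Bijection)
open import Induction.WellFounded using (WellFounded)
open import Relation.Binary.Bundles using (Setoid; StrictTotalOrder)
open import Relation.Binary.Core using (Rel)
open import Relation.Binary.Structures using (IsStrictTotalOrder)
open import Relation.Binary.Morphism.Structures using (IsOrderIsomorphism)
open import Relation.Binary.PropositionalEquality using (_≡_; setoid; _→-setoid_)
open import Relation.Nullary using (¬_)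
open import Relation.Unary using (Pred; _∈_; _⊆_)
open import Relation.Unary.Relation.Binary.Equality using (≐-setoid)
import Relation.Binary.Construct.On as On
import Relation.Binary.Construct.StrictToNonStrict as NonStrict

private
  variable
    a b c d p ℓ : Level

-- Sizes are compared between setoids, so that the subset of A cut out by a
-- predicate P can be taken as Σ A P with equality inherited from A: an element
-- is counted once, however many proofs of P it has.

_≼_ : Setoid a b → Setoid c d → Set (a ⊔ b ⊔ c ⊔ d)
A ≼ B = Injection A B

_≋_ : Setoid a b → Setoid c d → Set (a ⊔ b ⊔ c ⊔ d)
A ≋ B = Bijection A B

_≺_ : Setoid a b → Setoid c d → Set (a ⊔ b ⊔ c ⊔ d)
A ≺ B = A ≼ B × ¬ (A ≋ B)

sub : (A : Setoid a b) → Pred (Setoid.Carrier A) p → Setoid (a ⊔ p) b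
sub A P = On.setoid {B = Σ (Setoid.Carrier A) P} A proj₁

-- Cardinals are initial ordinals: well-orders strictly larger in size than
-- each of their proper initial segments.

record Cardinal (ℓ : Level) : Set (lsuc ℓ) where
  infix 4 _<_ _≤_
  field
    Carrier            : Set ℓ
    _<_                : Rel Carrier ℓ
    isStrictTotalOrder : IsStrictTotalOrder _≡_ _<_
    wellFounded        : WellFounded _<_
    initial            : ∀ α → sub (setoid Carrier) (_< α) ≺ setoid Carrier

  _≤_ : Rel Carrier ℓ
  _≤_ = NonStrict._≤_ _≡_ _<_

  order : StrictTotalOrder ℓ ℓ ℓ
  order = record { isStrictTotalOrder = isStrictTotalOrder }

  points : Setoid ℓ ℓ
  points = setoid Carrier

open Cardinal using (Carrier; order; points)

Infinite : Cardinal ℓ → Set ℓ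
Infinite κ = setoid ℕ ≼ points κ

-- μ is the least cardinality of a subset U of A with the property Φ.
IsLeastSize : (A : Setoid a b) → Pred (Pred (Setoid.Carrier A) ℓ) p →
              Cardinal ℓ → Set (a ⊔ b ⊔ lsuc ℓ ⊔ p)
IsLeastSize A Φ μ =
  (∃[ U ] (Φ U × sub A U ≋ points μ)) ×
  (∀ U → Φ U → points μ ≼ sub A U)

Cofinal : (κ : Cardinal ℓ) → Pred (Pred (Carrier κ) ℓ) ℓ
Cofinal κ S = ∀ α → ∃[ β ] (β ∈ S × α ≤ β)
  where open Cardinal κ using (_≤_)

IsCofinality : Cardinal ℓ → Cardinal ℓ → Set (lsuc ℓ)
IsCofinality κ μ = IsLeastSize (points κ) (Cofinal κ) μ

Regular : Cardinal ℓ → Set (lsuc ℓ)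
Regular κ = IsCofinality κ κ

IsSuccessor : Cardinal ℓ → Cardinal ℓ → Set (lsuc ℓ)
IsSuccessor {ℓ} κ κ⁺ =
  points κ ≺ points κ⁺ ×
  (∀ (μ : Cardinal ℓ) → points κ ≺ points μ → points κ⁺ ≼ points μ)

Unbounded : (κ : Cardinal ℓ) → Pred (Pred (Carrier κ → Carrier κ) ℓ) ℓ
Unbounded κ U =
  ¬ (Σ[ g ∈ (Carrier κ → Carrier κ) ] (∀ u → u ∈ U → sub (points κ) (λ ι → g ι ≤ u ι) ≺ points κ))
  where open Cardinal κ using (_≤_)

-- 𝔟_κ = μ
Is𝔟 : Cardinal ℓ → Cardinal ℓ → Set (lsuc ℓ)
Is𝔟 κ μ = IsLeastSize (Carrier κ →-setoid Carrier κ) (Unbounded κ) μ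

-- [ A ]^ μ: the subsets of A of cardinality μ.
[_]^_ : (A : Set ℓ) → Cardinal ℓ → Pred (Pred A ℓ) ℓ
[ A ]^ μ = λ x → sub (setoid A) x ≋ points μ

StickFamily : (κ κ⁺ : Cardinal ℓ) → Pred (Pred (Pred (Carrier κ⁺) ℓ) ℓ) (lsuc ℓ)
StickFamily κ κ⁺ X =
  X ⊆ [ Carrier κ⁺ ]^ κ ×
  (∀ y → y ∈ [ Carrier κ⁺ ]^ κ⁺ → ∃[ x ] (x ∈ X × x ⊆ y))

-- stick(κ) = μ.  Subsets of κ⁺ are identified when they have the same elements.
IsStick : Cardinal ℓ → Cardinal ℓ → Set (lsuc ℓ)
IsStick {ℓ} κ μ =
  ∃[ κ⁺ ] (IsSuccessor κ κ⁺ ×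
           IsLeastSize (≐-setoid (Carrier κ⁺) ℓ) (StickFamily κ κ⁺) μ)

LinearOrder : (ℓ : Level) → Set (lsuc ℓ)
LinearOrder ℓ = StrictTotalOrder ℓ ℓ ℓ

-- Having the same order type.
_≅_ : LinearOrder ℓ → LinearOrder ℓ → Set ℓ
P ≅ Q = ∃[ h ] IsOrderIsomorphism P._≈_ Q._≈_ P._<_ Q._<_ h
  where module P = StrictTotalOrder P
        module Q = StrictTotalOrder Q

suborder : (P : LinearOrder ℓ) → Pred (StrictTotalOrder.Carrier P) ℓ → LinearOrder ℓ
suborder P Q = On.strictTotalOrder {B = Σ (StrictTotalOrder.Carrier P) Q} P proj₁

points-of : LinearOrder ℓ → Setoid ℓ ℓ
points-of P = StrictTotalOrder.Eq.setoid P

-- λ · κ is κ many copies of λ one after another, so the κ-coordinate comes first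
-- in the lexicographic order.
infixl 7 _·_
_·_ : LinearOrder ℓ → LinearOrder ℓ → LinearOrder ℓ
L · K = ×-strictTotalOrder K L

-- Two-element subsets {x , y}, as pairs of distinct elements up to swapping.
[_]² : Setoid a b → Setoid (a ⊔ b) b
[ A ]² = record
  { Carrier       = ∃[ x ] ∃[ y ] ¬ (x ≈ y)
  ; _≈_           = λ (x , y , _) (x′ , y′ , _) →
                      (x ≈ x′ × y ≈ y′) ⊎ (x ≈ y′ × y ≈ x′)
  ; isEquivalence = record
    { refl  = inj₁ (refl , refl)
    ; sym   = λ { (inj₁ (e , e′)) → inj₁ (sym e , sym e′)
                ; (inj₂ (e , e′)) → inj₂ (sym e′ , sym e) }
    ; trans = λ { (inj₁ (e , e′)) (inj₁ (k , k′)) → inj₁ (trans e k , trans e′ k′)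
                ; (inj₁ (e , e′)) (inj₂ (k , k′)) → inj₂ (trans e k , trans e′ k′)
                ; (inj₂ (e , e′)) (inj₁ (k , k′)) → inj₂ (trans e k′ , trans e′ k)
                ; (inj₂ (e , e′)) (inj₂ (k , k′)) → inj₁ (trans e k′ , trans e′ k) }
    }
  }
  where open Setoid A

Colouring : Setoid a b → Set (a ⊔ b)
Colouring A = Func [ A ]² (setoid (Fin 2))

Homogeneous : (A : Setoid a b) → Colouring A → Fin 2 → Pred (Setoid.Carrier A) p → Set (a ⊔ b ⊔ p)
Homogeneous A f i Q =
  ∀ {x y} (x≉y : ¬ (x ≈ y)) → x ∈ Q → y ∈ Q → Func.to f (x , y , x≉y) ≡ i
  where open Setoid A

_⟶⟨_,_⟩² : LinearOrder ℓ → LinearOrder ℓ → ℕ → Set (lsuc ℓ)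
_⟶⟨_,_⟩² {ℓ} τ φ n =
  ∀ (P : LinearOrder ℓ) → P ≅ τ → (f : Colouring (points-of P)) →
    (∃[ Q ] (suborder P Q ≅ φ × Homogeneous (points-of P) f 0F Q)) ⊎
    (∃[ Q ] (sub (points-of P) Q ≋ setoid (Fin n) ×
             Homogeneous {p = ℓ} (points-of P) f 1F Q))

{-# OPTIONS --safe #-}

-- Write points of νκ as (i , α) with column i < κ and height α < ν. At
-- stage β < ν, a small (size < κ) set Treated β i of sticks is met in each
-- column i, by choosing for each of its
-- members γ an element node (β , i) γ of the γ-th stick. The point (j , β) is
-- joined to all chosen (i , α) with j < i and α < β. Choosing along i, a point
-- of column i is forbidden only if it is joined to a point chosen in an earlier
-- column; these points are few, whereas a stick has κ elements. So
-- neighbourhoods are independent, and there is no triangle.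
--
-- A copy of νκ has cofinally many heights in cofinally many columns i, hence
-- contains a stick γ i in each of these columns. An unbounded family of ν
-- functions κ → κ controls how much of each column is treated, so that for all
-- large β the stick γ i is treated at stage β for cofinally many i. This yields
-- an edge from a point at height β of the copy to another point of the copy.

module Submission where

open import Defs
open import Level using (Level; _⊔_) renaming (suc to lsuc)
open import Axiom.ExcludedMiddle using (ExcludedMiddle)
open import Axiom.Extensionality.Propositional using (Extensionality)
open import Data.Bool.Properties using (T-irrelevant)
open import Data.Empty using (⊥-elim)
open import Data.Fin using (Fin)
open import Data.Fin.Patterns using (0F; 1F; 2F)
open import Data.Nat.Properties using (0≢1+n)
open import Data.Product using (Σ; _×_; _,_; proj₁; proj₂; ∃-syntax; Σ-syntax)
open import Data.Product.Relation.Binary.Lex.Strict using (×-Lex; ×-wellFounded)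
open import Data.Product.Properties using (×-≡,≡→≡)
open import Data.Sum as Sum using (_⊎_; inj₁; inj₂)
open import Function using (_∘_; case_of_)
open import Function.Bundles using (Injection; Bijection; Inverse)
open import Function.Properties.Bijection using (Bijection⇒Inverse)
open import Function.Properties.Inverse using (Inverse⇒Injection) renaming (sym to Inverse-sym)
open import Induction.WellFounded using (WellFounded; module All; module FixPoint)
open import Relation.Binary.Bundles using (Setoid)
open import Relation.Binary.Definitions using (tri<; tri≈; tri>)
open import Relation.Binary.Morphism.Structures using (IsOrderIsomorphism)
open import Relation.Binary.PropositionalEquality
open import Relation.Binary.Structures using (IsStrictTotalOrder)
open import Relation.Nullary using (¬_; yes; no; contradiction)
open import Relation.Nullary.Decidable using (decidable-stable; True; toWitness; fromWitness)
open import Relation.Unary using (Pred; _∈_; _∉_; _⊆_)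
import Function.Construct.Composition as Composition
import Relation.Binary.Construct.On as On
import Relation.Binary.Construct.StrictToNonStrict as NonStrict

open Cardinal using (Carrier; points)

private
  variable
    a b c d e p q ℓ : Level

-- Comparing sizes of sets and subsets.

InjectiveOn : {A : Set a} {B : Set b} → (A → B) → Pred A p → Set (a ⊔ b ⊔ p)
InjectiveOn f S = ∀ {x y} → x ∈ S → y ∈ S → f x ≡ f y → x ≡ y

≼-trans : {A : Setoid a b} {B : Setoid c d} {C : Setoid e p} → A ≼ B → B ≼ C → A ≼ C
≼-trans = Composition.injection

≋⇒≼ : {A : Setoid a b} {B : Setoid c d} → A ≋ B → A ≼ B
≋⇒≼ = Bijection.injection

≋⇒≽ : {A : Setoid a b} {B : Setoid c d} → A ≋ B → B ≼ A
≋⇒≽ = Inverse⇒Injection ∘ Inverse-sym ∘ Bijection⇒Inverse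

sub-≼ : {A : Set a} {B : Set b} {S : Pred A p} (f : A → B) → InjectiveOn f S →
        sub (setoid A) S ≼ setoid B
sub-≼ f inj = record
  { to = f ∘ proj₁ ; cong = cong f ; injective = λ {(_ , s)} {(_ , t)} → inj s t }

≼-sub : {A : Set a} {B : Set b} {S : Pred B p} (f : A → B) →
        (∀ {x y} → f x ≡ f y → x ≡ y) → (∀ x → f x ∈ S) → setoid A ≼ sub (setoid B) S
≼-sub f inj f∈S = record { to = λ x → f x , f∈S x ; cong = cong f ; injective = inj }

-- Classical logic and choice.

module Classical (em : ∀ {ℓ : Level} → ExcludedMiddle ℓ) where

  by-contradiction : {A : Set a} → ¬ ¬ A → A
  by-contradiction = decidable-stable em

  ¬∀⇒∃¬ : {A : Set a} {P : Pred A p} → ¬ (∀ x → P x) → ∃[ x ] ¬ P x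
  ¬∀⇒∃¬ ¬∀ = by-contradiction λ ¬∃ → ¬∀ λ x → by-contradiction λ ¬Px → ¬∃ (x , ¬Px)

  opaque
    -- Excluded middle on the type of witnesses returns one. `default` covers empty fibres, so `f`
    -- needs no proof that a fibre is inhabited.
    choice : {A : Set a} {B : Set b} (R : A → Pred B p) → B →
             Σ[ f ∈ (A → B) ] (∀ {x y} → y ∈ R x → f x ∈ R x)
    choice {A = A} {B} R default = f , f-spec
      where
      f : A → B
      f x with em {P = ∃[ y ] R x y}
      ... | yes (y , _) = y
      ... | no _        = default

      f-spec : ∀ {x y} → y ∈ R x → f x ∈ R x
      f-spec {x} {y} Rxy with em {P = ∃[ y ] R x y}
      ... | yes (_ , Rxy′) = Rxy′
      ... | no ¬∃          = contradiction (y , Rxy) ¬∃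

  image-≼ : {A : Set a} {B : Set b} {T : Pred A p} {S : Pred B q} (g : A → B) → A →
            (∀ {y} → y ∈ S → ∃[ x ] (x ∈ T × g x ≡ y)) → sub (setoid B) S ≼ sub (setoid A) T
  image-≼ {T = T} g default onto = record
    { to        = λ (y , y∈S) → f y , proj₁ (spec y∈S)
    ; cong      = cong f
    ; injective = λ {(_ , y∈S)} {(_ , z∈S)} e →
        trans (sym (proj₂ (spec y∈S))) (trans (cong g e) (proj₂ (spec z∈S)))
    }
    where
    chosen = choice (λ y x → x ∈ T × g x ≡ y) default
    f = proj₁ chosen
    spec : ∀ {y} → _ → f y ∈ T × g (f y) ≡ y
    spec y∈S = proj₂ chosen (proj₂ (onto y∈S))

  -- The Schröder-Bernstein theorem.

  module SchröderBernstein {A : Setoid a b} {B : Setoid c d} (I : A ≼ B) (J : B ≼ A) where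
    private
      module A = Setoid A
      module B = Setoid B
      module I = Injection I
      module J = Injection J

    -- The orbit under `J` after `I` of the points outside the range of `J`. On it the bijection
    -- follows `I`, elsewhere the inverse of `J`.
    data Chain : Pred A.Carrier (a ⊔ b ⊔ c ⊔ d) where
      start : ∀ {x} → ¬ (∃[ y ] J.to y A.≈ x) → Chain x
      step  : ∀ {x x′} → Chain x → J.to (I.to x) A.≈ x′ → Chain x′

    chain-resp : ∀ {x x′} → x A.≈ x′ → Chain x → Chain x′
    chain-resp e (start ¬y)  = start λ (y , f) → ¬y (y , A.trans f (A.sym e))
    chain-resp e (step ch f) = step ch (A.trans f e)

    Match : A.Carrier → B.Carrier → Set (a ⊔ b ⊔ c ⊔ d)
    Match x y = (Chain x × I.to x B.≈ y) ⊎ (¬ Chain x × J.to y A.≈ x)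

    match : ∀ x → ∃[ y ] Match x y
    match x with em {P = Chain x}
    ... | yes ch = I.to x , inj₁ (ch , B.refl)
    ... | no ¬ch = let (y , e) = by-contradiction (¬ch ∘ start) in y , inj₂ (¬ch , e)

    match-functional : ∀ {x x′ y y′} → x A.≈ x′ → Match x y → Match x′ y′ → y B.≈ y′
    match-functional e (inj₁ (_ , f)) (inj₁ (_ , f′)) = B.trans (B.sym f) (B.trans (I.cong e) f′)
    match-functional e (inj₁ (ch , _)) (inj₂ (¬ch , _)) = contradiction (chain-resp e ch) ¬ch
    match-functional e (inj₂ (¬ch , _)) (inj₁ (ch , _)) = contradiction (chain-resp (A.sym e) ch) ¬ch
    match-functional e (inj₂ (_ , f)) (inj₂ (_ , f′)) = J.injective (A.trans f (A.trans e (A.sym f′)))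

    match-injective : ∀ {x x′ y y′} → y B.≈ y′ → Match x y → Match x′ y′ → x A.≈ x′
    match-injective e (inj₁ (_ , f)) (inj₁ (_ , f′)) = I.injective (B.trans f (B.trans e (B.sym f′)))
    match-injective e (inj₁ (ch , f)) (inj₂ (¬ch , f′)) =
      contradiction (step ch (A.trans (J.cong (B.trans f e)) f′)) ¬ch
    match-injective e (inj₂ (¬ch , f)) (inj₁ (ch , f′)) =
      contradiction (step ch (A.trans (J.cong (B.trans f′ (B.sym e))) f)) ¬ch
    match-injective e (inj₂ (_ , f)) (inj₂ (_ , f′)) = A.trans (A.sym f) (A.trans (J.cong e) f′)

    match-onto : ∀ y → ∃[ x ] Match x y
    match-onto y with em {P = Chain (J.to y)}
    ... | yes (start ¬y)          = contradiction (y , A.refl) ¬y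
    ... | yes (step {x = x} ch e) = x , inj₁ (ch , J.injective e)
    ... | no ¬ch                  = J.to y , inj₂ (¬ch , A.refl)

    bijection : A ≋ B
    bijection = record
      { to        = proj₁ ∘ match
      ; cong      = λ e → match-functional e (proj₂ (match _)) (proj₂ (match _))
      ; bijective = (λ e → match-injective e (proj₂ (match _)) (proj₂ (match _)))
                  , λ y → let (x , m) = match-onto y in
                          x , λ e → match-functional e (proj₂ (match _)) m
      }

  ≼-antisym : {A : Setoid a b} {B : Setoid c d} → A ≼ B → B ≼ A → A ≋ B
  ≼-antisym = SchröderBernstein.bijection

  -- Cardinals as well-orders; greedy enumeration.

  module CardinalProperties (ext : ∀ {a b : Level} → Extensionality a b) (μ : Cardinal ℓ) where
    open Cardinal μ public using (_<_; _≤_; wellFounded)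
    open Cardinal μ using (isStrictTotalOrder; initial)
    open IsStrictTotalOrder isStrictTotalOrder public using (compare; irrefl) renaming (trans to <-trans)
    open IsStrictTotalOrder isStrictTotalOrder using (<-resp-≈)

    <-irrefl : ∀ {x} → ¬ (x < x)
    <-irrefl = irrefl refl

    ≮⇒≥ : ∀ {x y} → ¬ (x < y) → y ≤ x
    ≮⇒≥ {x} {y} x≮y with compare x y
    ... | tri< x<y _ _ = contradiction x<y x≮y
    ... | tri≈ _ x≡y _ = inj₂ (sym x≡y)
    ... | tri> _ _ y<x = inj₁ y<x

    <-≤-trans : ∀ {x y z} → x < y → y ≤ z → x < z
    <-≤-trans = NonStrict.<-≤-trans _≡_ _<_ <-trans (proj₁ <-resp-≈)

    ≤-<-trans : ∀ {x y z} → x ≤ y → y < z → x < z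
    ≤-<-trans = NonStrict.≤-<-trans _≡_ _<_ sym <-trans (proj₂ <-resp-≈)

    ≤-trans : ∀ {x y z} → x ≤ y → y ≤ z → x ≤ z
    ≤-trans = NonStrict.trans _≡_ _<_ isEquivalence <-resp-≈ <-trans

    ≤⇒≯ : ∀ {x y} → x ≤ y → ¬ (y < x)
    ≤⇒≯ x≤y y<x = <-irrefl (≤-<-trans x≤y y<x)

    upper : ∀ x y → ∃[ z ] (x ≤ z × y ≤ z)
    upper x y with compare x y
    ... | tri< x<y _ _ = y , inj₁ x<y , inj₂ refl
    ... | tri≈ _ x≡y _ = y , inj₂ x≡y , inj₂ refl
    ... | tri> _ _ y<x = x , inj₂ refl , inj₁ y<x

    ¬cofinal⇒bounded : ∀ {S} → ¬ Cofinal μ S → ∃[ x ] (∀ {y} → y ∈ S → y < x)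
    ¬cofinal⇒bounded ¬cof with x , ¬above ← ¬∀⇒∃¬ ¬cof =
      x , λ y∈S → by-contradiction λ y≮x → ¬above (_ , y∈S , ≮⇒≥ y≮x)

    cofinal⇒¬bounded : ∀ {S x} → Cofinal μ S → ¬ (∀ {y} → y ∈ S → y < x)
    cofinal⇒¬bounded cof bounded = let (_ , y∈S , x≤y) = cof _ in ≤⇒≯ x≤y (bounded y∈S)

    segment-smaller : ∀ {x} → ¬ (points μ ≼ sub (points μ) (_< x))
    segment-smaller {x} I = let (J , J≭) = initial x in J≭ (≼-antisym J I)

    -- Enumerate Y greedily along μ: either every step finds a new element, or
    -- Y is exhausted at some step x.
    module _ {B : Set b} (Y : Pred B p) (default : B) where
      private
        new : ∀ x → (∀ y → y < x → B) → Pred B (ℓ ⊔ b ⊔ p)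
        new x earlier z = z ∈ Y × (∀ {y} (y<x : y < x) → ¬ (z ≡ earlier y y<x))

        next : ∀ x → (∀ y → y < x → B) → B
        next x earlier with em {P = ∃[ z ] new x earlier z}
        ... | yes (z , _) = z
        ... | no _        = default

        next-new : ∀ x earlier → ∃[ z ] new x earlier z → new x earlier (next x earlier)
        next-new x earlier ∃new with em {P = ∃[ z ] new x earlier z}
        ... | yes (_ , n) = n
        ... | no ¬∃       = contradiction ∃new ¬∃

        open All wellFounded b using () renaming (wfRec to rec)

        enum : Carrier μ → B
        enum = rec (λ _ → B) λ x earlier → next x λ _ → earlier

        enum-unfold : ∀ {x} → enum x ≡ next x (λ y _ → enum y)
        enum-unfold = FixPoint.unfold-wfRec wellFounded (λ _ → B) _ λ x IH≡ →
          cong (next x) (ext λ _ → ext λ y<x → IH≡ y<x)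

      enumerate-or-bound :
        (Σ[ f ∈ (Carrier μ → B) ] ((∀ {x y} → f x ≡ f y → x ≡ y) × (∀ x → f x ∈ Y)))
        ⊎ (∃[ x ] Σ[ r ∈ (B → Carrier μ) ] (InjectiveOn r Y × (∀ {y} → y ∈ Y → r y < x)))
      enumerate-or-bound with em {P = ∀ x → ∃[ z ] new x (λ y _ → enum y) z}
      ... | yes all = inj₁ (enum , enum-injective , λ x → proj₁ (enum-new x))
        where
        enum-new : ∀ x → new x (λ y _ → enum y) (enum x)
        enum-new x = subst (new x (λ y _ → enum y)) (sym enum-unfold) (next-new x _ (all x))

        enum-injective : ∀ {x y} → enum x ≡ enum y → x ≡ y
        enum-injective {x} {y} e with compare x y
        ... | tri< x<y _ _ = contradiction (sym e) (proj₂ (enum-new y) x<y)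
        ... | tri≈ _ x≡y _ = x≡y
        ... | tri> _ _ y<x = contradiction e (proj₂ (enum-new x) y<x)
      ... | no ¬all with x , ¬new ← ¬∀⇒∃¬ ¬all = inj₂ (x , index , index-injective , λ y∈Y → proj₁ (index-spec y∈Y))
        where
        found : ∀ {z} → z ∈ Y → ∃[ y ] (y < x × z ≡ enum y)
        found {z} z∈Y = by-contradiction λ ¬found →
          ¬new (z , z∈Y , λ {y} y<x e → ¬found (y , y<x , e))

        chosen : Σ[ f ∈ (B → Carrier μ) ] (∀ {z y} → y < x × z ≡ enum y → f z < x × z ≡ enum (f z))
        chosen = choice (λ z y → y < x × z ≡ enum y) x

        index : B → Carrier μ
        index = proj₁ chosen

        index-spec : ∀ {z} → z ∈ Y → index z < x × z ≡ enum (index z)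
        index-spec z∈Y = proj₂ chosen (proj₂ (found z∈Y))

        index-injective : InjectiveOn index Y
        index-injective x∈Y y∈Y e =
          trans (proj₂ (index-spec x∈Y)) (trans (cong enum e) (sym (proj₂ (index-spec y∈Y))))

  -- Regular cardinals and small sets.

  module RegularCardinal (ext : ∀ {a b : Level} → Extensionality a b)
                         (κ : Cardinal ℓ) (infinite : Infinite κ) (regular : Regular κ) where
    open CardinalProperties ext κ

    some : Carrier κ
    some = Injection.to infinite 0

    opaque
      -- A greatest `x` would make its singleton cofinal, and regularity would embed `κ`, hence ℕ,
      -- into one point.
      no-max : ∀ x → ∃[ y ] x < y
      no-max x = by-contradiction λ ¬above →
        let module J = Injection (proj₂ regular (_≡ x) λ y → x , refl , ≮⇒≥ λ x<y → ¬above (y , x<y))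
            J-constant : ∀ {s t} → proj₁ (J.to s) ≡ proj₁ (J.to t)
            J-constant {s} {t} = trans (proj₂ (J.to s)) (sym (proj₂ (J.to t)))
        in 0≢1+n {0} (Injection.injective infinite (J.injective J-constant))

      -- The image of a segment is no larger than the segment, so by regularity it is not cofinal.
      image-bounded : (g : Carrier κ → Carrier κ) → ∀ x → ∃[ y ] (∀ {v} → v < x → g v < y)
      image-bounded g x =
        let (y , bound) = ¬cofinal⇒bounded {S = λ w → ∃[ v ] (v < x × g v ≡ w)} λ cof →
              segment-smaller (≼-trans (proj₂ regular _ cof) (image-≼ g some λ w∈S → w∈S))
        in y , λ v<x → bound (_ , v<x , refl)

    ≺⇒bounded : ∀ {S} → sub (points κ) S ≺ points κ → ∃[ x ] (∀ {y} → y ∈ S → y < x)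
    ≺⇒bounded (S≼κ , S≭κ) = ¬cofinal⇒bounded λ cof → S≭κ (≼-antisym S≼κ (proj₂ regular _ cof))

    bounded⇒≺ : ∀ {S : Pred (Carrier κ) ℓ} {x} → (∀ {y} → y ∈ S → y < x) → sub (points κ) S ≺ points κ
    bounded⇒≺ bound = sub-≼ (λ y → y) (λ _ _ e → e) , λ S≋κ → segment-smaller
      (≼-trans (≋⇒≽ S≋κ) record { to = λ (y , y∈S) → y , bound y∈S ; cong = λ e → e ; injective = λ e → e })

    -- S has fewer than κ elements, in the form of the pigeonhole principle.
    Small : {X : Set ℓ} → Pred X ℓ → Set (lsuc ℓ)
    Small {X} S = (R : X → Pred (Carrier κ) ℓ) → Cofinal κ (λ t → ∃[ x ] (x ∈ S × R x t)) →
                  ∃[ x ] (x ∈ S × Cofinal κ (R x))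

    opaque
      -- If each `R v` were bounded, `image-bounded` would bound these bounds over `v < x`, and with
      -- them the union.
      segment-small : ∀ x → Small (_< x)
      segment-small x R cof = by-contradiction λ none →
        let bounded : ∀ {v} → v < x → ∃[ y ] (∀ {t} → t ∈ R v → t < y)
            bounded v<x = ¬cofinal⇒bounded λ c → none (_ , v<x , c)
            (g , g-spec) = choice (λ v y → ∀ {t} → t ∈ R v → t < y) some
            (_ , g<y) = image-bounded g x
        in cofinal⇒¬bounded cof λ (v , v<x , t∈Rv) →
             <-trans (g-spec (proj₂ (bounded v<x)) t∈Rv) (g<y v<x)

      singleton-small : {X : Set ℓ} (x : X) → Small (_≡ x)
      singleton-small x R cof = x , refl , λ t →
        let (u , (_ , e , u∈R) , t≤u) = cof t in u , subst (λ z → R z u) e u∈R , t≤u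

      ⋃-small : {X Y : Set ℓ} {S : Pred X ℓ} {F : X → Pred Y ℓ} →
                Small S → (∀ {x} → x ∈ S → Small (F x)) → Small (λ y → ∃[ x ] (x ∈ S × y ∈ F x))
      ⋃-small {F = F} S-small F-small R cof =
        let (x , x∈S , cof′) = S-small (λ x t → ∃[ y ] (y ∈ F x × R y t)) λ t →
              let (u , (y , (x , x∈S , y∈F) , u∈R) , t≤u) = cof t in u , (x , x∈S , y , y∈F , u∈R) , t≤u
            (y , y∈F , cof″) = F-small x∈S R cof′
        in y , (x , x∈S , y∈F) , cof″

      injection-small : {X : Set ℓ} {S : Pred X ℓ} (r : X → Carrier κ) → InjectiveOn r S →
                        ∀ {b} → (∀ {x} → x ∈ S → r x < b) → Small S
      injection-small {S = S} r inj r<b R cof =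
        let (v , _ , cof′) = segment-small _ (λ v t → ∃[ x ] (x ∈ S × r x ≡ v × R x t)) λ t →
              let (u , (x , x∈S , u∈R) , t≤u) = cof t in u , (r x , r<b x∈S , x , x∈S , refl , u∈R) , t≤u
            -- `cof′` may name a different element for each `t`; injectivity of `r` identifies them
            -- all with this one.
            (_ , (x , x∈S , rx≡v , _) , _) = cof′ some
        in x , x∈S , λ t →
             let (u , (y , y∈S , ry≡v , u∈R) , t≤u) = cof′ t
             in u , subst (λ z → R z u) (inj y∈S x∈S (trans ry≡v (sym rx≡v))) u∈R , t≤u

      -- Were every `f t` in `S`, one fibre of `f` would be cofinal; but fibres of an injection have
      -- at most one element, and `κ` has no maximum.
      small-avoidable : {X : Set ℓ} {S : Pred X ℓ} → Small S →
                        (f : Carrier κ → X) → (∀ {s t} → f s ≡ f t → s ≡ t) → ∃[ t ] f t ∉ S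
      small-avoidable {S = S} S-small f inj = ¬∀⇒∃¬ λ all →
        let (x , _ , cof) = S-small (λ x t → f t ≡ x) λ t → t , (f t , all t , refl) , inj₂ refl
            (t , ft≡x , _)   = cof some
            (t′ , t<t′)      = no-max t
            (u , fu≡x , t′≤u) = cof t′
        in ≤⇒≯ t′≤u (subst (_< t′) (inj (trans ft≡x (sym fu≡x))) t<t′)

  -- Segments of the successor cardinal.

  module SuccessorCardinal (ext : ∀ {a b : Level} → Extensionality a b)
                           (κ ν : Cardinal ℓ) (infinite : Infinite κ) (regular : Regular κ)
                           (successor : IsSuccessor κ ν) (ν≡𝔟 : Is𝔟 κ ν) where
    private
      module κ = CardinalProperties ext κ
      module ν = CardinalProperties ext ν
    open RegularCardinal ext κ infinite regular

    κ≼ν : points κ ≼ points ν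
    κ≼ν = proj₁ (proj₁ successor)

    ¬ν≼κ : ¬ (points ν ≼ points κ)
    ¬ν≼κ ν≼κ = proj₂ (proj₁ successor) (≼-antisym κ≼ν ν≼κ)

    someν : Carrier ν
    someν = Injection.to κ≼ν some

    HasIndex : Pred (Carrier ν) ℓ
    HasIndex β = Σ[ r ∈ (Carrier ν → Carrier κ) ] InjectiveOn r (ν._< β)

    -- A segment too large for κ all of whose proper segments embed in κ would
    -- be a cardinal strictly between κ and ν.
    segment-index-step : ∀ β → (∀ {δ} → δ ν.< β → HasIndex δ) → HasIndex β
    segment-index-step β indexed with κ.enumerate-or-bound (ν._< β) someν
    ... | inj₂ (_ , r , r-inj , _) = r , r-inj
    ... | inj₁ (f , f-inj , f<β) = by-contradiction λ unindexed →
      ν.segment-smaller (≼-trans (proj₂ successor (μ unindexed) (κ≺μ unindexed)) record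
        { to = λ δ → proj₁ δ , below δ ; cong = cong proj₁ ; injective = proj₁-injective })
        where
        -- `True` makes membership proof-irrelevant, so that `≡` on `segment`, which `Cardinal`
        -- uses, compares only the underlying points.
        segment : Set ℓ
        segment = Σ[ δ ∈ Carrier ν ] True (em {P = δ ν.< β})

        below : (δ : segment) → proj₁ δ ν.< β
        below (δ , t) = toWitness t

        member : ∀ {δ} → δ ν.< β → segment
        member δ<β = _ , fromWitness δ<β

        proj₁-injective : ∀ {δ ε : segment} → proj₁ δ ≡ proj₁ ε → δ ≡ ε
        proj₁-injective {δ , _} refl = cong (δ ,_) (T-irrelevant _ _)

        segment≼κ⇒indexed : setoid segment ≼ points κ → HasIndex β
        segment≼κ⇒indexed I =
          let (r , r-spec) = choice (λ δ t → Σ[ δ<β ∈ δ ν.< β ] Injection.to I (member δ<β) ≡ t) some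
          in r , λ x<β y<β e →
               let (x<β′ , ex) = r-spec {y = Injection.to I (member x<β)} (x<β , refl)
                   (y<β′ , ey) = r-spec {y = Injection.to I (member y<β)} (y<β , refl)
               in cong proj₁ (Injection.injective I (trans ex (trans e (sym ey))))

        module _ (unindexed : ¬ HasIndex β) where
          μ : Cardinal ℓ
          μ = record
            { Carrier            = segment
            ; _<_                = λ δ ε → proj₁ δ ν.< proj₁ ε
            ; isStrictTotalOrder = record
              { isStrictPartialOrder = record
                { isEquivalence = isEquivalence
                ; irrefl        = λ { refl → ν.<-irrefl }
                ; trans         = ν.<-trans
                ; <-resp-≈      = resp₂ _
                }
              ; compare = λ δ ε → case ν.compare (proj₁ δ) (proj₁ ε) of λ where
                  (tri< lt ¬eq ¬gt) → tri< lt (¬eq ∘ cong proj₁) ¬gt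
                  (tri≈ ¬lt eq ¬gt) → tri≈ ¬lt (proj₁-injective eq) ¬gt
                  (tri> ¬lt ¬eq gt) → tri> ¬lt (¬eq ∘ cong proj₁) gt
              }
            ; wellFounded        = On.wellFounded proj₁ ν.wellFounded
            ; initial            = λ δ →
                sub-≼ (λ ε → ε) (λ _ _ e → e) ,
                λ seg≋ → let (r , r-inj) = indexed (below δ) in
                  unindexed (segment≼κ⇒indexed (≼-trans (≋⇒≽ seg≋)
                    (sub-≼ (r ∘ proj₁) λ x<δ y<δ e → proj₁-injective (r-inj x<δ y<δ e))))
            }

          κ≺μ : points κ ≺ points μ
          κ≺μ = record { to = member ∘ f<β ; cong = λ { refl → refl } ; injective = f-inj ∘ cong proj₁ } ,
                λ κ≋μ → unindexed (segment≼κ⇒indexed (≋⇒≽ κ≋μ))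

    opaque
      segment-index : ∀ β → HasIndex β
      segment-index = All.wfRec ν.wellFounded ℓ HasIndex segment-index-step

    index : Carrier ν → Carrier ν → Carrier κ
    index β = proj₁ (segment-index β)

    index-injective : ∀ β → InjectiveOn (index β) (ν._< β)
    index-injective β = proj₂ (segment-index β)

    -- Eventual domination and regularity of `ν`.

    Function : Set ℓ
    Function = Carrier κ → Carrier κ

    infix 4 _<*_
    -- Since the subsets of `κ` of size below `κ` are the bounded ones, this is the domination that
    -- occurs in `Unbounded`.
    _<*_ : Function → Function → Set ℓ
    u <* g = ∃[ b ] (∀ {i} → b κ.≤ i → u i κ.< g i)

    <*⇒≺ : ∀ {u g} → u <* g → sub (points κ) (λ i → g i κ.≤ u i) ≺ points κ
    <*⇒≺ (b , u<g) = bounded⇒≺ λ {i} gi≤ui → by-contradiction λ i≮b →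
      κ.≤⇒≯ gi≤ui (u<g (κ.≮⇒≥ i≮b))

    ≺⇒<* : ∀ {u g} → sub (points κ) (λ i → g i κ.≤ u i) ≺ points κ → u <* g
    ≺⇒<* small with b , bound ← ≺⇒bounded small =
      b , λ b≤i → by-contradiction λ u≮g → κ.≤⇒≯ b≤i (bound (κ.≮⇒≥ u≮g))

    -- Otherwise the family is unbounded, so `ν` embeds into its range, hence into `S` and through
    -- `r` into `κ`.
    κ-many-dominated : {A : Set ℓ} (S : Pred A ℓ) (r : A → Carrier κ) → InjectiveOn r S → A →
                       (u : A → Function) → ∃[ g ] (∀ {x} → x ∈ S → u x <* g)
    κ-many-dominated S r r-inj default u = by-contradiction λ ¬∃g →
      let U = λ w → ∃[ x ] (x ∈ S × u x ≡ w)
          U-unbounded : Unbounded κ U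
          U-unbounded (g , bound) = ¬∃g (g , λ {x} x∈S → ≺⇒<* (bound (u x) (x , x∈S , refl)))
          U≡ : sub (Carrier κ →-setoid Carrier κ) U ≼ sub (setoid Function) U
          U≡ = record { to = λ w → w ; cong = ext ; injective = cong-app }
      in ¬ν≼κ (≼-trans (proj₂ ν≡𝔟 U U-unbounded)
           (≼-trans U≡ (≼-trans (image-≼ u default λ w∈U → w∈U) (sub-≼ r r-inj))))

    private
      U-bijection = proj₂ (proj₂ (proj₁ ν≡𝔟))
      module U = Bijection U-bijection

    family : Carrier ν → Function
    family β = proj₁ (U.to⁻ β)

    family-unbounded : ∀ g → ¬ (∀ β → family β <* g)
    family-unbounded g bound = proj₁ (proj₂ (proj₁ ν≡𝔟)) (g , λ w w∈U →
      subst (λ w → sub (points κ) (λ i → g i κ.≤ w i) ≺ points κ)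
        (ext (U.injective (proj₂ (U.strictlySurjective (U.to (w , w∈U))))))
        (<*⇒≺ (bound (U.to (w , w∈U)))))

    -- If γ had no strict upper bound, then κ many functions, namely a bound for
    -- each {family δ ∣ δ ≤ γ i}, would dominate the whole unbounded family.
    opaque
      ν-regular : (γ : Carrier κ → Carrier ν) → ∃[ β ] (∀ i → γ i ν.< β)
      ν-regular γ = by-contradiction λ ¬bounded →
        let earlier i = κ-many-dominated (ν._< γ i) (index (γ i)) (index-injective (γ i)) someν family
            everything : Pred (Carrier κ) ℓ
            everything i = i ≡ i
            (g , g-bound) = κ-many-dominated everything (λ i → i) (λ _ _ e → e) some (proj₁ ∘ earlier)
            -- `earlier i` covers only the indices below `γ i`; `h` covers `γ i` itself.
            (h , h-bound) = κ-many-dominated everything (λ i → i) (λ _ _ e → e) some (family ∘ γ)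
            max : Function
            max i = proj₁ (κ.upper (g i) (h i))
            ≤g⇒<*max : ∀ {u} → u <* g → u <* max
            ≤g⇒<*max = λ (b , u<g) → b , λ b≤i → κ.<-≤-trans (u<g b≤i) (proj₁ (proj₂ (κ.upper _ _)))
            ≤h⇒<*max : ∀ {u} → u <* h → u <* max
            ≤h⇒<*max = λ (b , u<h) → b , λ b≤i → κ.<-≤-trans (u<h b≤i) (proj₂ (proj₂ (κ.upper _ _)))
        in family-unbounded max λ β →
             let (i , γi≮β) = ¬∀⇒∃¬ λ γ<β → ¬bounded (β , γ<β) in
             case ν.≮⇒≥ γi≮β of λ where
               (inj₁ β<γi) → ≤g⇒<*max (<*-trans (proj₂ (earlier i) β<γi) (g-bound refl))
               (inj₂ β≡γi) → ≤h⇒<*max (subst (λ δ → family δ <* h) (sym β≡γi) (h-bound refl))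
        where
        <*-trans : ∀ {u v w} → u <* v → v <* w → u <* w
        <*-trans (b , u<v) (c , v<w) = let (d , b≤d , c≤d) = κ.upper b c in
          d , λ d≤i → κ.<-trans (u<v (κ.≤-trans b≤d d≤i)) (v<w (κ.≤-trans c≤d d≤i))

    -- Large subsets of `ν` and sticks.

    κ-sized-bounded : ∀ {S : Pred (Carrier ν) ℓ} (r : Carrier ν → Carrier κ) → InjectiveOn r S →
                      ∃[ β ] (∀ {α} → α ∈ S → α ν.< β)
    κ-sized-bounded {S} r r-inj =
      -- `f` inverts `r`, so `S` lies in the range of a `κ`-sequence.
      let (f , f-spec) = choice (λ t α → α ∈ S × r α ≡ t) someν
          (β , f<β)    = ν-regular f
      in β , λ α∈S → let (fr∈S , e) = f-spec (α∈S , refl) in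
           subst (ν._< β) (r-inj fr∈S α∈S e) (f<β _)

    -- If the enumeration of `S` stopped early, `S` would embed into a segment of `ν`, hence into
    -- `κ`, and would be bounded.
    cofinal⇒ν≼ : ∀ {S} → Cofinal ν S →
                 Σ[ f ∈ (Carrier ν → Carrier ν) ] ((∀ {x y} → f x ≡ f y → x ≡ y) × (∀ x → f x ∈ S))
    cofinal⇒ν≼ {S} cof with ν.enumerate-or-bound S someν
    ... | inj₁ embedding = embedding
    ... | inj₂ (β , r , r-inj , r<β) =
      let (_ , bound) = κ-sized-bounded (index β ∘ r) λ x∈S y∈S e →
            r-inj x∈S y∈S (index-injective β (r<β x∈S) (r<β y∈S) e)
      in ⊥-elim (ν.cofinal⇒¬bounded cof bound)

    -- Any two successors of κ are equinumerous, so the sticks may be taken in ν.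
    opaque
      sticks : IsStick κ ν →
               Σ[ x ∈ (Carrier ν → Carrier κ → Carrier ν) ]
                 ((∀ γ {s t} → x γ s ≡ x γ t → s ≡ t) ×
                  (∀ {S} → Cofinal ν S → ∃[ γ ] (∀ t → x γ t ∈ S)))
      sticks (κ⁺ , successor′ , (X , (X-sized , X-stick) , X≋ν) , _) = stick , stick-injective , stick-in
        where
        ν≋κ⁺ : points ν ≋ points κ⁺
        ν≋κ⁺ = ≼-antisym (proj₂ successor κ⁺ (proj₁ successor′)) (proj₂ successor′ ν (proj₁ successor))

        module φ = Inverse (Bijection⇒Inverse ν≋κ⁺)
        module X = Bijection X≋ν

        enumeration : ∀ γ → points κ ≼ sub (points κ⁺) (proj₁ (X.to⁻ γ))
        enumeration γ = ≋⇒≽ (X-sized (proj₂ (X.to⁻ γ)))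

        stick : Carrier ν → Carrier κ → Carrier ν
        stick γ t = φ.from (proj₁ (Injection.to (enumeration γ) t))

        stick-injective : ∀ γ {s t} → stick γ s ≡ stick γ t → s ≡ t
        stick-injective γ e = Injection.injective (enumeration γ) (Injection.injective (≋⇒≽ ν≋κ⁺) e)

        stick-in : ∀ {S} → Cofinal ν S → ∃[ γ ] (∀ t → stick γ t ∈ S)
        stick-in {S} cof =
          let (f , f-inj , f∈S) = cofinal⇒ν≼ cof
              φS : Pred (Carrier κ⁺) _
              φS w = φ.from w ∈ S
              κ⁺≼φS : points κ⁺ ≼ sub (points κ⁺) φS
              κ⁺≼φS = ≼-trans (≋⇒≽ ν≋κ⁺) (≼-sub (φ.to ∘ f) (f-inj ∘ Injection.injective (≋⇒≼ ν≋κ⁺))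
                        λ α → subst S (sym (φ.strictlyInverseʳ (f α))) (f∈S α))
              (x , x∈X , x⊆φS) = X-stick φS (≼-antisym (sub-≼ (λ w → w) (λ _ _ e → e)) κ⁺≼φS)
              γ = X.to (x , x∈X)
              X-γ≐x = X.injective (proj₂ (X.strictlySurjective γ))
          -- `X.to⁻ γ` agrees with `x` only as a set, so membership is carried across `X-γ≐x`.
          in γ , λ t → x⊆φS (proj₁ X-γ≐x (proj₂ (Injection.to (enumeration γ) t)))

    -- Copies of `νκ` inside itself.

    module _ (q : Carrier κ × Carrier ν → Carrier κ × Carrier ν)
             (q-mono : ∀ {x y} → ×-Lex _≡_ κ._<_ ν._<_ x y → ×-Lex _≡_ κ._<_ ν._<_ (q x) (q y)) where
      private
        column : Carrier κ → Carrier ν → Carrier κ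
        column k z = proj₁ (q (k , z))

        height : Carrier κ → Carrier ν → Carrier ν
        height k z = proj₂ (q (k , z))

        column-mono : ∀ {k z k′ z′} → ×-Lex _≡_ κ._<_ ν._<_ (k , z) (k′ , z′) → column k z κ.≤ column k′ z′
        column-mono lt with q-mono lt
        ... | inj₁ c<c′       = inj₁ c<c′
        ... | inj₂ (c≡c′ , _) = inj₂ c≡c′

        column-mono-≤ : ∀ {k z z′} → z ν.≤ z′ → column k z κ.≤ column k z′
        column-mono-≤ (inj₁ z<z′) = column-mono (inj₂ (refl , z<z′))
        column-mono-≤ (inj₂ refl) = inj₂ refl

        -- A monotone map ν → κ is eventually constant, since ν is regular.
        column-stabilises : ∀ k → ∃[ z₀ ] (∀ {z} → z₀ ν.≤ z → column k z₀ ≡ column k z)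
        column-stabilises k =
          let (f , f-spec) = choice (λ c z → c κ.< column k z) someν
              (z₀ , f<z₀)  = ν-regular f
          in z₀ , λ {z} z₀≤z → case column-mono-≤ z₀≤z of λ where
               (inj₁ c₀<c) → ⊥-elim (κ.≤⇒≯ (column-mono-≤ (inj₁ (f<z₀ (column k z₀)))) (f-spec {y = z} c₀<c))
               (inj₂ c₀≡c) → c₀≡c

        stable : Carrier κ → Carrier ν
        stable k = proj₁ (column-stabilises k)

        limit : Carrier κ → Carrier κ
        limit k = column k (stable k)

        limit≡ : ∀ {k z} → stable k ν.≤ z → limit k ≡ column k z
        limit≡ {k} = proj₂ (column-stabilises k)

        height-mono : ∀ {k z z′} → stable k ν.≤ z → z ν.< z′ → height k z ν.< height k z′
        height-mono {k} z₀≤z z<z′ with q-mono (inj₂ (refl , z<z′))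
        ... | inj₂ (_ , h<h′) = h<h′
        ... | inj₁ c<c′       = ⊥-elim (κ.<-irrefl (subst₂ κ._<_
                (sym (limit≡ z₀≤z)) (sym (limit≡ (ν.≤-trans z₀≤z (inj₁ z<z′)))) c<c′))

        height-injective : ∀ {k} → InjectiveOn (height k) (stable k ν.≤_)
        height-injective {x = z} {z′} z₀≤z z₀≤z′ e with ν.compare z z′
        ... | tri< z<z′ _ _ = ⊥-elim (ν.irrefl e (height-mono z₀≤z z<z′))
        ... | tri≈ _ z≡z′ _ = z≡z′
        ... | tri> _ _ z′<z = ⊥-elim (ν.irrefl (sym e) (height-mono z₀≤z′ z′<z))

        -- The tail of block `k` has distinct heights. If these stayed below `α`, the tail would
        -- embed into `κ` and be bounded in `ν`.
        height-cofinal : ∀ k α → ∃[ z ] (stable k ν.≤ z × α ν.≤ height k z)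
        height-cofinal k α = by-contradiction λ none →
          let height<α = λ {z} (z₀≤z : stable k ν.≤ z) → by-contradiction λ h≮α → none (z , z₀≤z , ν.≮⇒≥ h≮α)
              (β , z<β) = κ-sized-bounded {S = stable k ν.≤_} (index α ∘ height k) λ z₀≤z z₀≤z′ e →
                height-injective z₀≤z z₀≤z′ (index-injective α (height<α z₀≤z) (height<α z₀≤z′) e)
          -- `β` exceeds `stable k`, so it lies in the tail that it bounds.
          in ν.<-irrefl (z<β (inj₁ (z<β (inj₂ refl))))

        -- Some point of block `k` has an image at least as high as that of `(k′ , stable k′)` but
        -- preceding it, so the column must be strictly smaller.
        limit-mono : ∀ {k k′} → k κ.< k′ → limit k κ.< limit k′
        limit-mono {k} {k′} k<k′ with height-cofinal k (height k′ (stable k′))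
        ... | z , z₀≤z , h′≤h with q-mono {k , z} {k′ , stable k′} (inj₁ k<k′)
        ... | inj₁ c<c′       = subst (κ._< limit k′) (sym (limit≡ z₀≤z)) c<c′
        ... | inj₂ (_ , h<h′) = ⊥-elim (ν.≤⇒≯ h′≤h h<h′)

        limit-inflationary : ∀ k → k κ.≤ limit k
        limit-inflationary k = κ.≮⇒≥ (All.wfRec κ.wellFounded ℓ (λ k → ¬ (limit k κ.< k))
          (λ k IH lt → IH lt (limit-mono lt)) k)

      range-cofinal : ∀ {Q : Pred (Carrier κ × Carrier ν) ℓ} → (∀ x → q x ∈ Q) →
                      Cofinal κ (λ i → Cofinal ν (λ α → Q (i , α)))
      range-cofinal {Q} q∈Q k = limit k , (λ α →
        let (z , z₀≤z , α≤h) = height-cofinal k α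
        in height k z , subst (λ i → Q (i , height k z)) (sym (limit≡ z₀≤z)) (q∈Q (k , z)) , α≤h) ,
        limit-inflationary k

    -- The scale and the treated sticks.

    module Graph (ν≡stick : IsStick κ ν) where

      stick : Carrier ν → Carrier κ → Carrier ν
      stick = proj₁ (sticks ν≡stick)

      stick-injective : ∀ γ {s t} → stick γ s ≡ stick γ t → s ≡ t
      stick-injective = proj₁ (proj₂ (sticks ν≡stick))

      stick-in : ∀ {S} → Cofinal ν S → ∃[ γ ] (∀ t → stick γ t ∈ S)
      stick-in = proj₂ (proj₂ (sticks ν≡stick))

      opaque
        dominating : ∀ β → ∃[ g ] (∀ {δ} → δ ν.< β → family δ <* g)
        dominating β = κ-many-dominated (ν._< β) (index β) (index-injective β) someν family

      -- Taking suprema over initial segments makes the family unbounded on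
      -- every cofinal subset of κ, not just on κ.
      scale-bound : ∀ β j → ∃[ y ] (∀ {i} → i κ.< proj₁ (no-max j) → proj₁ (dominating β) i κ.< y)
      scale-bound β j = image-bounded (proj₁ (dominating β)) (proj₁ (no-max j))

      scale : Carrier ν → Function
      scale β j = proj₁ (scale-bound β j)

      -- Some `family δ` is not dominated by `h ∘ next`. For `β` above `δ`, `dominating β` is
      -- eventually above `family δ`, and `scale β` at `next i` exceeds `dominating β` at `i`. So
      -- `h` is exceeded at points `next i` of `I`.
      scale-unbounded : ∀ {I} → Cofinal κ I → (h : Function) →
        ∃[ δ ] (∀ {β} → δ ν.< β → ∀ b → ∃[ j ] (j ∈ I × b κ.≤ j × h j κ.< scale β j))
      scale-unbounded {I} cof h =
        let next i = proj₁ (cof i)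
            (δ , ¬dominated) = ¬∀⇒∃¬ (family-unbounded (h ∘ next))
        in δ , λ {β} δ<β b →
          let (b₀ , dom) = proj₂ (dominating β) δ<β
              (c , b≤c , b₀≤c) = κ.upper b b₀
              (i , c≤i , u≮h) = by-contradiction λ none → ¬dominated
                (c , λ {i} c≤i → by-contradiction λ u≮h → none (i , c≤i , u≮h))
              (j∈I , i≤j) = proj₂ (cof i)
          in next i , j∈I , κ.≤-trans b≤c (κ.≤-trans c≤i i≤j) ,
             κ.≤-<-trans (κ.≮⇒≥ u≮h)
               (κ.<-trans (dom (κ.≤-trans b₀≤c c≤i))
                 (proj₂ (scale-bound β (next i)) (κ.≤-<-trans i≤j (proj₂ (no-max (next i))))))

      -- The detour through δ makes the position of γ, measured inside a fixed δ,
      -- independent of β; only the position of δ itself varies with β.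
      Treated : Carrier ν → Carrier κ → Pred (Carrier ν) ℓ
      Treated β i γ = ∃[ δ ] ((δ ν.< β × index β δ κ.< scale β i) ×
                              (γ ν.< δ × index δ γ κ.< scale β i))

      treated-small : ∀ β i → Small (Treated β i)
      treated-small β i =
        ⋃-small (injection-small (index β) (λ x y → index-injective β (proj₁ x) (proj₁ y)) proj₂)
          λ {δ} _ → injection-small (index δ) (λ x y → index-injective δ (proj₁ x) (proj₁ y)) proj₂

      -- Recursive choice of the nodes.

      Position : Set ℓ
      Position = Carrier ν × Carrier κ

      _⊏_ : Position → Position → Set ℓ
      _⊏_ = ×-Lex _≡_ ν._<_ κ._<_

      opaque
        ⊏-wellFounded : WellFounded _⊏_
        ⊏-wellFounded = ×-wellFounded ν.wellFounded κ.wellFounded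

      Earlier : Position → Set ℓ
      Earlier p = ∀ p′ → p′ ⊏ p → Carrier ν → Carrier ν

      -- `(j , β′)` is a neighbour of the points at height `β` left of it, and `(i , α)` may be a
      -- neighbour of `(j , β′)`, so choosing `α` could close a triangle. Both uses of `earlier`
      -- descend in `⊏`, the second because of `β′<β`.
      Forbidden : ∀ p → Earlier p → Pred (Carrier ν) ℓ
      Forbidden (β , i) earlier α =
        Σ[ j ∈ Carrier κ ] Σ[ j<i ∈ j κ.< i ] Σ[ γ ∈ Carrier ν ] (γ ∈ Treated β j ×
          (let β′ = earlier (β , j) (inj₂ (refl , j<i)) γ in
           Σ[ β′<β ∈ β′ ν.< β ] ∃[ γ′ ] (γ′ ∈ Treated β′ i × α ≡ earlier (β′ , i) (inj₁ β′<β) γ′)))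

      -- Existence of a permitted entry is left as a hypothesis here; `node-allowed` supplies it for
      -- the actual recursion.
      allowed : ∀ p (earlier : Earlier p) →
        Σ[ f ∈ (Carrier ν → Carrier κ) ] (∀ {γ t} → stick γ t ∉ Forbidden p earlier →
                                           stick γ (f γ) ∉ Forbidden p earlier)
      allowed p earlier = choice (λ γ t → stick γ t ∉ Forbidden p earlier) some

      step : ∀ p → Earlier p → Carrier ν → Carrier ν
      step p earlier γ = stick γ (proj₁ (allowed p earlier) γ)

      opaque
        node : Position → Carrier ν → Carrier ν
        node = All.wfRec ⊏-wellFounded ℓ (λ _ → Carrier ν → Carrier ν) λ p earlier → step p λ _ → earlier

        node-unfold : ∀ p → node p ≡ step p (λ p′ _ → node p′)
        node-unfold p = FixPoint.unfold-wfRec ⊏-wellFounded (λ _ → Carrier ν → Carrier ν) _ λ p IH≡ →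
          cong (step p) (ext λ _ → ext λ p′⊏p → IH≡ p′⊏p)

      node-in-stick : ∀ p γ → ∃[ t ] node p γ ≡ stick γ t
      node-in-stick p γ = _ , cong-app (node-unfold p) γ

      -- Forbidden without the proof that β′ precedes β.
      Blocked : Position → Pred (Carrier ν) ℓ
      Blocked (β , i) α = ∃[ j ] (j κ.< i × ∃[ γ ] (γ ∈ Treated β j ×
        ∃[ γ′ ] (γ′ ∈ Treated (node (β , j) γ) i × α ≡ node (node (β , j) γ , i) γ′)))

      blocked-small : ∀ p → Small (Blocked p)
      blocked-small (β , i) =
        ⋃-small (segment-small i) λ {j} _ → ⋃-small (treated-small β j) λ {γ} _ →
          ⋃-small (treated-small (node (β , j) γ) i) λ {γ′} _ → singleton-small _

      forbidden⊆blocked : ∀ p → Forbidden p (λ p′ _ → node p′) ⊆ Blocked p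
      forbidden⊆blocked p (j , j<i , γ , γ∈T , _ , γ′ , γ′∈T , e) = j , j<i , γ , γ∈T , γ′ , γ′∈T , e

      -- A stick has `κ` distinct entries and `Blocked p` is small, so a permitted entry exists and
      -- `allowed` has picked one.
      node-allowed : ∀ p γ → node p γ ∉ Forbidden p (λ p′ _ → node p′)
      node-allowed p γ
        with t , t∉blocked ← small-avoidable (blocked-small p) (stick γ) (stick-injective γ) =
        subst (_∉ Forbidden p (λ p′ _ → node p′)) (sym (cong-app (node-unfold p) γ))
          (proj₂ (allowed p (λ p′ _ → node p′)) {γ} {t} (t∉blocked ∘ forbidden⊆blocked p))

      -- Edges and their orientation.

      Point : Set ℓ
      Point = Carrier κ × Carrier ν

      Edge : Point → Point → Set ℓ
      Edge (j , β) (i , α) = j κ.< i × α ν.< β × ∃[ γ ] (γ ∈ Treated β i × α ≡ node (β , i) γ)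

      edge⇒distinct : ∀ {x y} → Edge x y → proj₁ x ≢ proj₁ y
      edge⇒distinct (j<i , _) e = κ.irrefl e j<i

      edge-acyclic : ∀ {x y z} → Edge x y → Edge y z → ¬ Edge z x
      edge-acyclic (k<j , _) (j<i , _) (i<k , _) = κ.<-irrefl (κ.<-trans k<j (κ.<-trans j<i i<k))

      -- The path through `y` makes the height of `z` forbidden at the stage of `x` in the column of
      -- `z`, where an edge from `x` to `z` would have it chosen.
      edge-intransitive : ∀ {x y z} → Edge x y → Edge y z → ¬ Edge x z
      edge-intransitive (_ , β<γ , ξ , ξ∈T , refl) (j<i , _ , ξ′ , ξ′∈T , e′) (_ , _ , ξ″ , _ , e″) =
        node-allowed _ ξ″ (_ , j<i , ξ , ξ∈T , β<γ , ξ′ , ξ′∈T , trans (sym e″) e′)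

      -- Edges inside large sets.

      treated-eventually : ∀ {I} → Cofinal κ I → (γ : Carrier κ → Carrier ν) →
        ∃[ ε ] (∀ {β} → ε ν.< β → ∀ b → ∃[ i ] (i ∈ I × b κ.≤ i × γ i ∈ Treated β i))
      treated-eventually cof γ =
        let (β₀ , γ<β₀) = ν-regular γ
            -- Neither `i` nor the position of `γ i` below `β₀` depends on `β`, so one use of
            -- `scale-unbounded` serves all later stages.
            h-bound = λ i → κ.upper i (index β₀ (γ i))
            (δ , unbounded) = scale-unbounded cof (proj₁ ∘ h-bound)
            (ε , δ≤ε , β₀≤ε) = ν.upper δ β₀
        in ε , λ {β} ε<β b →
          -- From `b′` on, the position of `β₀` below `β` is at most `i`, hence at most `h i`; so
          -- `β₀` can be the detour in `Treated`.
          let (b′ , b≤b′ , index≤b′) = κ.upper b (index β β₀)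
              (i , i∈I , b′≤i , h<scale) = unbounded (ν.≤-<-trans δ≤ε ε<β) b′
              (i≤h , index≤h) = proj₂ (h-bound i)
          in i , i∈I , κ.≤-trans b≤b′ b′≤i , β₀ ,
             (ν.≤-<-trans β₀≤ε ε<β , κ.≤-<-trans (κ.≤-trans index≤b′ (κ.≤-trans b′≤i i≤h)) h<scale) ,
             (γ<β₀ i , κ.≤-<-trans index≤h h<scale)

      cofinal⇒edge : (Q : Pred Point ℓ) → Cofinal κ (λ i → Cofinal ν (λ α → Q (i , α))) →
                     ∃[ x ] ∃[ y ] (x ∈ Q × y ∈ Q × Edge x y)
      cofinal⇒edge Q cof =
        let (γ , γ-spec) = choice (λ i γ → ∀ t → Q (i , stick γ t)) someν
            -- Above every entry of every stick `γ i`, which puts any node on them below a stage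
            -- past `β₁`.
            (β₁ , bound<β₁) = ν-regular λ i → proj₁ (ν-regular (stick (γ i)))
            (ε , treated) = treated-eventually cof γ
            (ζ , β₁≤ζ , ε≤ζ) = ν.upper β₁ ε
            -- Cofinality gives only `ξ ≤ β`, so `ξ` is taken strictly above `ζ`.
            (ξ , ζ<ξ) = ν-regular λ _ → ζ
            (j , cofⱼ , _) = cof some
            (β , Qjβ , ξ≤β) = cofⱼ ξ
            ζ<β = ν.<-≤-trans (ζ<ξ some) ξ≤β
            -- Forces the treated column `i` to lie strictly to the right of `j`.
            (b , j<b) = no-max j
            (i , cofᵢ , b≤i , γᵢ-treated) = treated (ν.≤-<-trans ε≤ζ ζ<β) b
            (t , node≡) = node-in-stick (β , i) (γ i)
            stick<β = ν.<-trans (proj₂ (ν-regular (stick (γ i))) t)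
                        (ν.<-trans (bound<β₁ i) (ν.≤-<-trans β₁≤ζ ζ<β))
        in (j , β) , (i , node (β , i) (γ i)) , Qjβ ,
           subst (λ α → Q (i , α)) (sym node≡) (γ-spec (proj₂ (stick-in cofᵢ)) t) ,
           κ.<-≤-trans j<b b≤i , subst (ν._< β) (sym node≡) stick<β , γ i , γᵢ-treated , refl

      -- The colouring.

      τ : LinearOrder ℓ
      τ = Cardinal.order ν · Cardinal.order κ

      copy⇒edge : ∀ {Q} → suborder τ Q ≅ τ → ∃[ x ] ∃[ y ] (x ∈ Q × y ∈ Q × Edge x y)
      copy⇒edge {Q} (h , iso) = cofinal⇒edge Q (range-cofinal (proj₁ ∘ preimage) preimage-mono (proj₂ ∘ preimage))
        where
        open IsOrderIsomorphism iso using (surjective; cancel)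

        preimage : Point → Σ Point Q
        preimage y = proj₁ (surjective y)

        h-preimage : ∀ y → h (preimage y) ≡ y
        h-preimage y = ×-≡,≡→≡ (proj₂ (surjective y) (refl , refl))

        preimage-mono : ∀ {x y} → ×-Lex _≡_ κ._<_ ν._<_ x y →
                        ×-Lex _≡_ κ._<_ ν._<_ (proj₁ (preimage x)) (proj₁ (preimage y))
        preimage-mono {x} {y} x<y = cancel {preimage x} {preimage y}
          (subst₂ (×-Lex _≡_ κ._<_ ν._<_) (sym (h-preimage x)) (sym (h-preimage y)) x<y)

      Adjacent : Point → Point → Set ℓ
      Adjacent x y = Edge x y ⊎ Edge y x

      -- Of the eight orientations two are cyclic, contradicting the increase of columns; the other
      -- six are transitive triangles.
      no-triangle : ∀ {x y z} → Adjacent x y → Adjacent y z → ¬ Adjacent x z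
      no-triangle (inj₁ xy) (inj₁ yz) (inj₁ xz) = edge-intransitive xy yz xz
      no-triangle (inj₁ xy) (inj₁ yz) (inj₂ zx) = edge-acyclic xy yz zx
      no-triangle (inj₁ xy) (inj₂ zy) (inj₁ xz) = edge-intransitive xz zy xy
      no-triangle (inj₁ xy) (inj₂ zy) (inj₂ zx) = edge-intransitive zx xy zy
      no-triangle (inj₂ yx) (inj₁ yz) (inj₁ xz) = edge-intransitive yx xz yz
      no-triangle (inj₂ yx) (inj₁ yz) (inj₂ zx) = edge-intransitive yz zx yx
      no-triangle (inj₂ yx) (inj₂ zy) (inj₁ xz) = edge-acyclic yx xz zy
      no-triangle (inj₂ yx) (inj₂ zy) (inj₂ zx) = edge-intransitive zy yx zx

      colour : Point → Point → Fin 2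
      colour x y with em {P = Adjacent x y}
      ... | yes _ = 1F
      ... | no _  = 0F

      colour-sym : ∀ x y → colour x y ≡ colour y x
      colour-sym x y with em {P = Adjacent x y} | em {P = Adjacent y x}
      ... | yes _   | yes _   = refl
      ... | yes adj | no ¬adj = contradiction (Sum.swap adj) ¬adj
      ... | no ¬adj | yes adj = contradiction (Sum.swap adj) ¬adj
      ... | no _    | no _    = refl

      colour≡0⇒¬adjacent : ∀ x y → colour x y ≡ 0F → ¬ Adjacent x y
      colour≡0⇒¬adjacent x y e adj with em {P = Adjacent x y}
      ... | no ¬adj = ¬adj adj

      colour≡1⇒adjacent : ∀ x y → colour x y ≡ 1F → Adjacent x y
      colour≡1⇒adjacent x y e with em {P = Adjacent x y}
      ... | yes adj = adj

      colouring : Colouring (points-of τ)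
      colouring = record
        { to   = λ (x , y , _) → colour x y
        ; cong = λ { (inj₁ ((refl , refl) , (refl , refl))) → refl
                   ; {x , y , _} (inj₂ ((refl , refl) , (refl , refl))) → colour-sym x y }
        }

      not-arrow : ¬ (τ ⟶⟨ τ , 3 ⟩²)
      not-arrow arrow with arrow τ ≅-refl colouring
        where
        ≅-refl : τ ≅ τ
        ≅-refl = (λ x → x) , record
          { isOrderMonomorphism = record
            { isOrderHomomorphism = record { cong = λ e → e ; mono = λ lt → lt }
            ; injective = λ e → e
            ; cancel    = λ lt → lt
            }
          ; surjective = λ y → y , λ e → e
          }
      ... | inj₁ (Q , Q≅τ , hom) =
        let (x , y , x∈Q , y∈Q , edge) = copy⇒edge Q≅τ
        in colour≡0⇒¬adjacent x y (hom {x} {y} (edge⇒distinct edge ∘ proj₁) x∈Q y∈Q) (inj₁ edge)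
      ... | inj₂ (Q , Q≋3 , hom) =
        no-triangle (adjacent 0F 1F λ ()) (adjacent 1F 2F λ ()) (adjacent 0F 2F λ ())
        where
        module Q = Injection (≋⇒≽ Q≋3)

        adjacent : ∀ m n → m ≢ n → Adjacent (proj₁ (Q.to m)) (proj₁ (Q.to n))
        adjacent m n m≢n = colour≡1⇒adjacent _ _
          (hom (m≢n ∘ Q.injective) (proj₂ (Q.to m)) (proj₂ (Q.to n)))

theorem4p2 : (∀ {ℓ : Level} → ExcludedMiddle ℓ) →
    (∀ {a b : Level} → Extensionality a b) →
    ∀ {ℓ : Level} (κ ν : Cardinal ℓ) →
    Infinite κ → Regular κ →
    IsSuccessor κ ν → Is𝔟 κ ν → IsStick κ ν →
    ¬ ((Cardinal.order ν · Cardinal.order κ) ⟶⟨ Cardinal.order ν · Cardinal.order κ , 3 ⟩²)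
theorem4p2 em ext κ ν infinite regular successor ν≡𝔟 ν≡stick =
  Classical.SuccessorCardinal.Graph.not-arrow em ext κ ν infinite regular successor ν≡𝔟 ν≡stick
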